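{- For every positive integer $N$, $$\sum_{\lambda\in\mathcal{OP}_N} t^{\ell(\lambda)}q^{|\lambda|}=\sum_{\mu\in\mathcal{L}_N} t^{|\mu|_a}q^{|\mu|}=\prod_{k=1}^{N}\frac{1}{1-tq^{2k-1}}$$ as formal power series in $t,q$.
   Context: A partition is a finite weakly decreasing sequence $\lambda=(\lambda_1\ge\lambda_2\ge\dots\ge\lambda_\ell>0)$ of positive integers (the empty partition $\emptyset$ is allowed); $\ell(\lambda)=\ell$ is its length and $|\lambda|=\sum_i\lambda_i$ its size. The alternating size is $|\lambda|_a=\sum_{k=1}^{\ell(\lambda)}(-1)^{k+1}\lambda_k$. For a positive integer $N$, $\mathcal{L}_N$ is the set of partitions $\mu$ with $\ell(\mu)\le N$ and $$\frac{\mu_1}{N}\ge\frac{\mu_2}{N-1}\ge\dots\ge\frac{\mu_{\ell(\mu)}}{N-\ell(\mu)+1}$$ (lecture hall partitions of width $N$; $\emptyset\in\mathcal{L}_N$). $\mathcal{OP}_N$ is the set of partitions all of whose parts are odd and at most $2N$ (so parts lie in $\{1,3,\dots,2N-1\}$). -}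

module Defs where

open import Data.Bool.Base using (if_then_else_; _∧_)
open import Data.Integer.Base as ℤ using (ℤ; +_; 0ℤ; 1ℤ; ∣_∣)
open import Data.Integer.Properties as ℤₚ using ()
open import Data.Integer.Tactic.RingSolver using (solve-∀)
open import Data.List.Base using (List; []; _∷_; foldr; length; map)
open import Data.List.Membership.Propositional using (_∈_)
open import Data.List.Relation.Binary.Permutation.Propositional
  using (_↭_; ↭⇒↭ₛ)
open import Data.List.Relation.Binary.Permutation.Propositional.Properties using (map⁺)
open import Data.List.Membership.Propositional.Properties.WithK using (unique∧set⇒bag)
open import Data.List.Relation.Binary.BagAndSetEquality using (∼bag⇒↭)
open import Data.List.Relation.Binary.Permutation.Setoid.Properties using (foldr-commMonoid)
open import Data.List.Relation.Unary.All using (All; []; _∷_)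
open import Data.List.Relation.Unary.Linked as Linked using (Linked; []; [-]; _∷_)
open import Data.List.Relation.Unary.Unique.Propositional using (Unique)
open import Data.Nat.Base using (ℕ; zero; suc; _+_; _∸_; _*_; _≤_; _<_; _≥_; z≤n; s≤s)
open import Data.Nat.Divisibility using (_∣_)
open import Data.Nat.ListAction using (sum)
import Data.Nat.Properties as ℕₚ
open import Data.Product.Base using (Σ-syntax; _×_; _,_)
open import Data.Rational.Unnormalised.Base as ℚ using (ℚᵘ; _/_)
open import Function.Bundles using (_⇔_; mk⇔; Equivalence)
open import Relation.Binary.PropositionalEquality
open import Relation.Nullary using (¬_)
open import Relation.Nullary.Decidable using (⌊_⌋)

------------------------------------------------------------------------
-- Partitions

IsPartition : List ℕ → Set
IsPartition λs = Linked _≥_ λs × All (0 <_) λs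

altSum : List ℕ → ℤ
altSum []       = 0ℤ
altSum (x ∷ xs) = + x ℤ.- altSum xs

-- The alternating sum of a partition is nonnegative (altSum-nonneg below), so
-- taking the absolute value only serves to obtain a natural-number exponent.
altSize : List ℕ → ℕ
altSize λs = ∣ altSum λs ∣

-- μ₁ / N , μ₂ / (N - 1) , … ; only used for lists of length at most N, where
-- no denominator vanishes and the first clause is reached only with [].
ratios : ℕ → List ℕ → List ℚᵘ
ratios zero    _        = []
ratios (suc n) []       = []
ratios (suc n) (x ∷ xs) = (+ x / suc n) ∷ ratios n xs

LectureHall : ℕ → List ℕ → Set
LectureHall N μ = IsPartition μ × length μ ≤ N × Linked ℚ._≥_ (ratios N μ)

OddParts : ℕ → List ℕ → Set
OddParts N λs = IsPartition λs × All (λ p → ¬ 2 ∣ p × p ≤ 2 * N) λs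

------------------------------------------------------------------------
-- Formal power series in t and q over ℤ:  f i j  is the coefficient of tⁱ qʲ

PowerSeries : Set
PowerSeries = ℕ → ℕ → ℤ

infix 4 _≈_
_≈_ : PowerSeries → PowerSeries → Set
f ≈ g = ∀ i j → f i j ≡ g i j

t^_q^_ : ℕ → ℕ → PowerSeries
(t^ a q^ b) i j = if ⌊ i ℕₚ.≟ a ⌋ ∧ ⌊ j ℕₚ.≟ b ⌋ then 1ℤ else 0ℤ

𝟙 : PowerSeries
𝟙 = t^ 0 q^ 0

infixl 6 _⊖_
_⊖_ : PowerSeries → PowerSeries → PowerSeries
(f ⊖ g) i j = f i j ℤ.- g i j

∑≤ : ℕ → (ℕ → ℤ) → ℤ
∑≤ zero    c = c 0
∑≤ (suc n) c = ∑≤ n c ℤ.+ c (suc n)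

infixl 7 _⊗_
_⊗_ : PowerSeries → PowerSeries → PowerSeries
(f ⊗ g) i j = ∑≤ i λ a → ∑≤ j λ b → f a b ℤ.* g (i ∸ a) (j ∸ b)

_^^_ : PowerSeries → ℕ → PowerSeries
f ^^ zero  = 𝟙
f ^^ suc n = f ⊗ (f ^^ n)

-- The reciprocal of a series with constant term 1, as Σₙ (1 - f)ⁿ: the n-th
-- power only has terms of total degree at least n, so the coefficient of tⁱ qʲ
-- is reached by n ≤ i + j.  See inverse-correct below.
inverse : PowerSeries → PowerSeries
inverse f i j = ∑≤ (i + j) λ n → ((𝟙 ⊖ f) ^^ n) i j

∏₁ : ℕ → (ℕ → PowerSeries) → PowerSeries
∏₁ zero    f = 𝟙
∏₁ (suc n) f = ∏₁ n f ⊗ f (suc n)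

syntax ∏₁ N (λ k → f) = ∏[1≤ k ≤ N ] f

sumℤ : List ℤ → ℤ
sumℤ = foldr ℤ._+_ 0ℤ

-- Summability of a family of power series over the set { x ∣ P x }, with sum s:
-- for each monomial only finitely many members have a nonzero coefficient (xs
-- lists them without repetition), and these coefficients add up to that of s.
HasSum : {A : Set} → (A → Set) → (A → PowerSeries) → PowerSeries → Set
HasSum {A} P f s = ∀ i j → Σ[ xs ∈ List A ]
  Unique xs ×
  (∀ {x} → x ∈ xs ⇔ (P x × f x i j ≢ 0ℤ)) ×
  sumℤ (map (λ x → f x i j) xs) ≡ s i j

------------------------------------------------------------------------
-- The definitions above behave as intended

private
  sumℤ-↭ : ∀ {xs ys} → xs ↭ ys → sumℤ xs ≡ sumℤ ys
  sumℤ-↭ p = foldr-commMonoid (setoid ℤ) ℤₚ.+-0-isCommutativeMonoid (↭⇒↭ₛ p)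

HasSum-unique : ∀ {A : Set} {P : A → Set} {f : A → PowerSeries} {s s′} →
                HasSum P f s → HasSum P f s′ → s ≈ s′
HasSum-unique {f = f} h h′ i j with h i j | h′ i j
... | xs , u , m , e | ys , u′ , m′ , e′ = trans (sym e) (trans (sumℤ-↭ (map⁺ _ xs↭ys)) e′)
  where
  open Equivalence
  xs↭ys : xs ↭ ys
  xs↭ys = ∼bag⇒↭ (unique∧set⇒bag u u′ (mk⇔ (λ z → from m′ (to m z)) (λ z → from m (to m′ z))))

altSum-nonneg : ∀ {λs} → IsPartition λs → 0ℤ ℤ.≤ altSum λs
altSum-nonneg (d , _) = nonneg d
  where
  nonneg : ∀ {xs} → Linked _≥_ xs → 0ℤ ℤ.≤ altSum xs
  upper  : ∀ {x xs} → Linked _≥_ (x ∷ xs) → altSum (x ∷ xs) ℤ.≤ + x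

  nonneg []                  = ℤₚ.≤-refl
  nonneg ([-] {x})              = ℤₚ.i≤j⇒0≤j-i (ℤ.+≤+ z≤n)
  nonneg (_∷_ {x} {y} x≥y d) = ℤₚ.i≤j⇒0≤j-i (ℤₚ.≤-trans (upper d) (ℤ.+≤+ x≥y))

  upper {x} {xs} d =
    ℤₚ.i-j≤i (+ x) (altSum xs) {{ℤ.nonNegative (nonneg (Linked.tail d))}}

private
  shrink : ∀ {k n} → suc k ≤ n → n ∸ suc k < n
  shrink {k} (s≤s {n = n} _) = s≤s (ℕₚ.m∸n≤m n k)

  ∑-cong : ∀ n {c d : ℕ → ℤ} → (∀ k → k ≤ n → c k ≡ d k) → ∑≤ n c ≡ ∑≤ n d
  ∑-cong zero    e = e 0 z≤n
  ∑-cong (suc n) e = cong₂ ℤ._+_ (∑-cong n λ k k≤n → e k (ℕₚ.m≤n⇒m≤1+n k≤n)) (e (suc n) ℕₚ.≤-refl)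

  ∑-zero : ∀ n {c : ℕ → ℤ} → (∀ k → k ≤ n → c k ≡ 0ℤ) → ∑≤ n c ≡ 0ℤ
  ∑-zero zero    e = e 0 z≤n
  ∑-zero (suc n) e =
    cong₂ ℤ._+_ (∑-zero n λ k k≤n → e k (ℕₚ.m≤n⇒m≤1+n k≤n)) (e (suc n) ℕₚ.≤-refl)

  ∑-first : ∀ n {c : ℕ → ℤ} → (∀ k → c (suc k) ≡ 0ℤ) → ∑≤ n c ≡ c 0
  ∑-first zero    e = refl
  ∑-first (suc n) e = trans (cong₂ ℤ._+_ (∑-first n e) (e n)) (ℤₚ.+-identityʳ _)

  ∑-+ : ∀ n (c d : ℕ → ℤ) → ∑≤ n (λ k → c k ℤ.+ d k) ≡ ∑≤ n c ℤ.+ ∑≤ n d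
  ∑-+ zero    c d = refl
  ∑-+ (suc n) c d = trans
    (cong (ℤ._+ (c (suc n) ℤ.+ d (suc n))) (∑-+ n c d))
    (shuffle (∑≤ n c) (∑≤ n d) (c (suc n)) (d (suc n)))
    where
    shuffle : ∀ w x y z → (w ℤ.+ x) ℤ.+ (y ℤ.+ z) ≡ (w ℤ.+ y) ℤ.+ (x ℤ.+ z)
    shuffle = solve-∀

  ∑²-+ : ∀ i j (c d : ℕ → ℕ → ℤ) →
         (∑≤ i λ a → ∑≤ j λ b → c a b ℤ.+ d a b) ≡
         (∑≤ i λ a → ∑≤ j (c a)) ℤ.+ (∑≤ i λ a → ∑≤ j (d a))
  ∑²-+ i j c d = trans (∑-cong i λ a _ → ∑-+ j (c a) (d a)) (∑-+ i _ _)

  ∑²-cong : ∀ i j {c d : ℕ → ℕ → ℤ} →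
            (∀ a b → a ≤ i → b ≤ j → c a b ≡ d a b) →
            (∑≤ i λ a → ∑≤ j (c a)) ≡ (∑≤ i λ a → ∑≤ j (d a))
  ∑²-cong i j e = ∑-cong i λ a a≤i → ∑-cong j λ b b≤j → e a b a≤i b≤j

  𝟙⊗ : ∀ g → 𝟙 ⊗ g ≈ g
  𝟙⊗ g i j = trans (∑-first i λ a → ∑-zero j λ b _ → refl)
           (trans (∑-first j λ b → refl) (ℤₚ.*-identityˡ _))

  partial : PowerSeries → ℕ → PowerSeries
  partial u M i j = ∑≤ M λ n → (u ^^ n) i j

  module _ (f : PowerSeries) where
    u : PowerSeries
    u = 𝟙 ⊖ f

    -- f g + (1 - f) g = g
    f⊗+u⊗ : ∀ g i j → (f ⊗ g) i j ℤ.+ (u ⊗ g) i j ≡ g i j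
    f⊗+u⊗ g i j = trans (sym (∑²-+ i j _ _))
      (trans (∑²-cong i j λ a b _ _ → lemma (f a b) (𝟙 a b) (g (i ∸ a) (j ∸ b))) (𝟙⊗ g i j))
      where
      lemma : ∀ x y z → x ℤ.* z ℤ.+ (y ℤ.- x) ℤ.* z ≡ y ℤ.* z
      lemma = solve-∀

    telescope : ∀ M i j → (f ⊗ partial u M) i j ℤ.+ (u ^^ suc M) i j ≡ 𝟙 i j
    telescope zero    i j = f⊗+u⊗ 𝟙 i j
    telescope (suc M) i j = begin
      (f ⊗ partial u (suc M)) i j ℤ.+ (u ^^ suc (suc M)) i j
        ≡⟨ cong (ℤ._+ (u ^^ suc (suc M)) i j) (trans
             (∑²-cong i j λ a b _ _ → ℤₚ.*-distribˡ-+ (f a b) _ _) (∑²-+ i j _ _)) ⟩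
      ((f ⊗ partial u M) i j ℤ.+ (f ⊗ (u ^^ suc M)) i j) ℤ.+ (u ^^ suc (suc M)) i j
        ≡⟨ ℤₚ.+-assoc ((f ⊗ partial u M) i j) _ _ ⟩
      (f ⊗ partial u M) i j ℤ.+ ((f ⊗ (u ^^ suc M)) i j ℤ.+ (u ^^ suc (suc M)) i j)
        ≡⟨ cong (λ z → (f ⊗ partial u M) i j ℤ.+ z) (f⊗+u⊗ (u ^^ suc M) i j) ⟩
      (f ⊗ partial u M) i j ℤ.+ (u ^^ suc M) i j
        ≡⟨ telescope M i j ⟩
      𝟙 i j ∎
      where open ≡-Reasoning

    module _ (f₀₀ : f 0 0 ≡ 1ℤ) where
      vanish : ∀ n i j → i + j < n → (u ^^ n) i j ≡ 0ℤ
      vanish (suc n) i j (s≤s i+j≤n) = ∑-zero i λ a a≤i → ∑-zero j λ b b≤j → term a b a≤i b≤j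
        where
        term : ∀ a b → a ≤ i → b ≤ j → u a b ℤ.* (u ^^ n) (i ∸ a) (j ∸ b) ≡ 0ℤ
        term zero zero _ _ = cong (λ x → (1ℤ ℤ.- x) ℤ.* (u ^^ n) i j) f₀₀
        term zero (suc b) _ b<j = trans
          (cong (u 0 (suc b) ℤ.*_) (vanish n i (j ∸ suc b) (ℕₚ.<-≤-trans
            (ℕₚ.+-monoʳ-< i (shrink b<j)) i+j≤n)))
          (ℤₚ.*-zeroʳ (u 0 (suc b)))
        term (suc a) b a<i _ = trans
          (cong (u (suc a) b ℤ.*_) (vanish n (i ∸ suc a) (j ∸ b) (ℕₚ.<-≤-trans
            (ℕₚ.+-mono-<-≤ (shrink a<i) (ℕₚ.m∸n≤m j b)) i+j≤n)))
          (ℤₚ.*-zeroʳ (u (suc a) b))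

      stable : ∀ d i j → partial u (d + (i + j)) i j ≡ inverse f i j
      stable zero    i j = refl
      stable (suc d) i j = trans
        (cong₂ ℤ._+_ (stable d i j) (vanish (suc d + (i + j)) i j (s≤s (ℕₚ.m≤n+m (i + j) d))))
        (ℤₚ.+-identityʳ _)

      stable′ : ∀ {M} i j → i + j ≤ M → inverse f i j ≡ partial u M i j
      stable′ {M} i j le = trans (sym (stable (M ∸ (i + j)) i j))
        (cong (λ m → partial u m i j) (ℕₚ.m∸n+n≡m le))

inverse-correct : ∀ f → f 0 0 ≡ 1ℤ → f ⊗ inverse f ≈ 𝟙
inverse-correct f f₀₀ i j = begin
  (f ⊗ inverse f) i j
    ≡⟨ (∑²-cong i j λ a b _ _ → cong (f a b ℤ.*_)
         (stable′ f f₀₀ (i ∸ a) (j ∸ b) (ℕₚ.+-mono-≤ (ℕₚ.m∸n≤m i a) (ℕₚ.m∸n≤m j b)))) ⟩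
  (f ⊗ partial (u f) (i + j)) i j
    ≡⟨ ℤₚ.+-identityʳ _ ⟨
  (f ⊗ partial (u f) (i + j)) i j ℤ.+ 0ℤ
    ≡⟨ cong (λ z → (f ⊗ partial (u f) (i + j)) i j ℤ.+ z) (vanish f f₀₀ (suc (i + j)) i j ℕₚ.≤-refl) ⟨
  (f ⊗ partial (u f) (i + j)) i j ℤ.+ (u f ^^ suc (i + j)) i j
    ≡⟨ telescope f (i + j) i j ⟩
  𝟙 i j ∎
  where open ≡-Reasoning

{-# OPTIONS --safe #-}
-- Both families are parametrised by vectors c ∈ ℕᴺ, with t-exponent Σ cₖ and
-- q-exponent Σ (2k - 1) cₖ, whose generating function is the product. An odd
-- partition has cₖ parts equal to 2k - 1. For lecture hall partitions there is
-- (Bousquet-Mélou and Eriksson) a bijection ℕ × 𝓛ₙ → 𝓛ₙ₊₁, (s , μ) ↦ λ: the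
-- entries at even positions of λ are μ₁, μ₃, …; once these are fixed each
-- λ₃, λ₅, … ranges over an interval whose ends have the form ⌈(m+1) y / m⌉ and
-- ⌊(m-1) y / m⌋, in which μ₂, μ₄, … is reflected, and s is the excess of λ₁ over
-- its least value. As the two ends attached to the same y sum to 2 y,
-- |λ|ₐ = s + |μ|ₐ and |λ| = s + |μ| + 2 |μ|ₐ, which is also the effect of adding
-- 2 to every part of an odd partition and then s parts equal to 1.
module Submission where

open import Data.Empty using (⊥-elim)
open import Data.Integer.Base as ℤ using (ℤ; 0ℤ; 1ℤ; ∣_∣)
import Data.Integer.Properties as ℤₚ
import Data.Integer.Tactic.RingSolver as ℤ-Solver
open import Data.List.Base using (List; []; _∷_; _++_; length; map; cartesianProductWith)
import Data.List.Properties as Listₚ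
open import Data.List.Membership.Propositional using (_∈_)
open import Data.List.Membership.Propositional.Properties
open import Data.List.Relation.Unary.Any using (here; there)
import Data.List.Relation.Unary.AllPairs as AllPairs
open import Data.List.Relation.Unary.All as All using (All; []; _∷_)
open import Data.List.Relation.Unary.Linked as Linked using (Linked; []; [-]; _∷_)
open import Data.List.Relation.Unary.Linked.Properties using (Linked⇒All)
open import Data.List.Relation.Unary.Unique.Propositional using (Unique)
import Data.List.Relation.Unary.Unique.Propositional.Properties as Uniqueₚ
open import Data.Nat.Base
open import Data.Nat.Divisibility using (_∣_; m∣m*n; ∣m+n∣m⇒∣n; ∣1⇒≡1)
open import Data.Nat.DivMod using (_/_; _%_; m≡m%n+[m/n]*n; m%n<n; m<n*o⇒m/o<n)
open import Data.Nat.ListAction using (sum)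
open import Data.Nat.Properties
open import Data.Nat.Tactic.RingSolver using (solve-∀)
import Data.Rational.Unnormalised.Base as ℚ
import Data.Rational.Unnormalised.Properties as ℚₚ
open import Data.Product.Base using (Σ-syntax; ∃-syntax; _×_; _,_; proj₁; proj₂)
open import Data.Sum.Base using (inj₁; inj₂)
open import Data.Unit.Base using (⊤; tt)
open import Data.Vec.Base as Vec using (Vec; []; _∷_; _∷ʳ_; init; last; replicate)
open import Data.Vec.Properties using (∷-injectiveˡ; ∷-injectiveʳ; init-∷ʳ; last-∷ʳ)
open import Function.Bundles using (_⇔_; mk⇔; Equivalence)
open import Relation.Binary.PropositionalEquality
open import Relation.Nullary using (¬_; yes; no; contradiction)
open import Defs

-- Multiplicity vectors and their exponents

part : ℕ → ℕ
-- Written as the exponent `2 * k ∸ 1` at `k = suc n`, with which it agrees by computation in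
-- `Counts-Vec`.
part n = 2 * suc n ∸ 1

-- The head of c : Vec ℕ n is the multiplicity of the largest part 2n - 1.
total weight : ∀ {n} → Vec ℕ n → ℕ
total []                  = 0
total (c ∷ v)             = c + total v
weight []                 = 0
weight {suc n} (c ∷ v)    = c * part n + weight v

total-∷ʳ : ∀ {n} (v : Vec ℕ n) s → total (v ∷ʳ s) ≡ s + total v
total-∷ʳ []      s = refl
total-∷ʳ (c ∷ v) s = trans (cong (c +_) (total-∷ʳ v s)) (lemma c s (total v))
  where
  lemma : ∀ c s t → c + (s + t) ≡ s + (c + t)
  lemma = solve-∀

-- Appending an entry shifts every earlier one to the next larger odd part, so each of the `total v`
-- parts grows by 2; the new entry counts parts equal to 1.
weight-∷ʳ : ∀ {n} (v : Vec ℕ n) s → weight (v ∷ʳ s) ≡ s + (weight v + 2 * total v)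
weight-∷ʳ []      s = lemma s
  where
  lemma : ∀ s → s * 1 + 0 ≡ s + 0
  lemma = solve-∀
weight-∷ʳ {suc n} (c ∷ v) s = trans
  (cong₂ _+_ (cong (c *_) (part-suc n)) (weight-∷ʳ v s))
  (lemma c (part n) s (weight v) (total v))
  where
  part-suc : ∀ n → part (suc n) ≡ 2 + part n
  part-suc n = cong suc (+-suc n (suc (n + 0)))
  lemma : ∀ c p s w t → c * (2 + p) + (s + (w + 2 * t)) ≡ s + (c * p + w + 2 * (c + t))
  lemma = solve-∀

-- The lecture hall bijection

⌈_/1+_⌉ : ℕ → ℕ → ℕ
⌈ zero  /1+ k ⌉ = 0
⌈ suc x /1+ k ⌉ = suc (x / suc k)

⌈/⌉≤⇒≤* : ∀ {k} x {d} → ⌈ x /1+ k ⌉ ≤ d → x ≤ d * suc k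
⌈/⌉≤⇒≤* zero    _ = z≤n
⌈/⌉≤⇒≤* {k} (suc x) {d} q<d = begin-strict
  x                                  ≡⟨ m≡m%n+[m/n]*n x (suc k) ⟩
  x % suc k + x / suc k * suc k      <⟨ +-monoˡ-< _ (m%n<n x (suc k)) ⟩
  suc (x / suc k) * suc k            ≤⟨ *-monoˡ-≤ (suc k) q<d ⟩
  d * suc k                          ∎
  where open ≤-Reasoning

≤*⇒⌈/⌉≤ : ∀ {k} x {d} → x ≤ d * suc k → ⌈ x /1+ k ⌉ ≤ d
≤*⇒⌈/⌉≤ zero    _  = z≤n
≤*⇒⌈/⌉≤ (suc x) le = m<n*o⇒m/o<n le

⌈/⌉≤ : ∀ {k} x → ⌈ x /1+ k ⌉ ≤ x
⌈/⌉≤ {k} x = ≤*⇒⌈/⌉≤ x (m≤m*n x (suc k))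

-- For an entry y at width k + 1:  up k y  is the least admissible entry at
-- width k + 2 before it, and  down k y  the greatest admissible one at width k
-- after it.
up down : ℕ → ℕ → ℕ
up   k y = y + ⌈ y /1+ k ⌉
down k y = y ∸ ⌈ y /1+ k ⌉

-- The two ceilings cancel, since `⌈ y /1+ k ⌉ ≤ y` makes the subtraction exact. This removes all
-- rounding from the sums in `odds-step`.
up+down : ∀ k y → up k y + down k y ≡ 2 * y
up+down k y = begin
  y + c + (y ∸ c)   ≡⟨ +-assoc y c _ ⟩
  y + (c + (y ∸ c)) ≡⟨ cong (y +_) (m+[n∸m]≡n (⌈/⌉≤ y)) ⟩
  y + y             ≡⟨ cong (_+_ y) (+-identityʳ y) ⟨
  2 * y             ∎
  where
  open ≡-Reasoning
  c = ⌈ y /1+ k ⌉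

-- y + ⌈y/m⌉ ≤ x  ⇔  ⌈y/m⌉ ≤ x - y  ⇔  y ≤ (x - y) m, and similarly for down.
up≤⇒*≤ : ∀ {k} x y → up k y ≤ x → y * suc (suc k) ≤ x * suc k
up≤⇒*≤ {k} x y le = begin
  y * suc (suc k)           ≡⟨ *-suc y (suc k) ⟩
  y + y * suc k             ≤⟨ +-monoˡ-≤ _ (⌈/⌉≤⇒≤* y (m+n≤o⇒m≤o∸n _ (subst (_≤ x) (+-comm y _) le))) ⟩
  (x ∸ y) * suc k + y * suc k ≡⟨ *-distribʳ-+ (suc k) (x ∸ y) y ⟨
  (x ∸ y + y) * suc k       ≡⟨ cong (_* suc k) (m∸n+n≡m (m+n≤o⇒m≤o y le)) ⟩
  x * suc k                 ∎
  where open ≤-Reasoning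

*≤⇒up≤ : ∀ {k} x y → y * suc (suc k) ≤ x * suc k → up k y ≤ x
*≤⇒up≤ {k} x y le = subst (_≤ x) (+-comm _ y) (m≤n∸o⇒m+o≤n _ y≤x (≤*⇒⌈/⌉≤ y (begin
  y                             ≤⟨ m+n≤o⇒m≤o∸n y (≤-trans (≤-reflexive (sym (*-suc y (suc k)))) le) ⟩
  x * suc k ∸ y * suc k         ≡⟨ *-distribʳ-∸ (suc k) x y ⟨
  (x ∸ y) * suc k               ∎)))
  where
  open ≤-Reasoning
  y≤x : y ≤ x
  y≤x = *-cancelʳ-≤ y x (suc k) (≤-trans (*-monoʳ-≤ y (n≤1+n (suc k))) le)
  m≤n∸o⇒m+o≤n : ∀ m {n o} → o ≤ n → m ≤ n ∸ o → m + o ≤ n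
  m≤n∸o⇒m+o≤n m {n} {o} o≤n le = ≤-trans (+-monoˡ-≤ o le) (≤-reflexive (m∸n+n≡m o≤n))

-- With `up≤⇒≤down` this is a Galois connection: both sides say y (k + 2) ≤ x (k + 1), so one
-- condition on neighbours reads as a bound on either of them.
≤down⇒up≤ : ∀ {k} x y → y ≤ down (suc k) x → up k y ≤ x
≤down⇒up≤ {k} x y y≤d = *≤⇒up≤ x y (begin
  y * M          ≤⟨ *-monoˡ-≤ M y≤d ⟩
  (x ∸ c) * M    ≡⟨ *-distribʳ-∸ M x c ⟩
  x * M ∸ c * M  ≤⟨ ∸-monoʳ-≤ (x * M) (⌈/⌉≤⇒≤* x ≤-refl) ⟩
  x * M ∸ x      ≡⟨ cong (_∸ x) (*-suc x (suc k)) ⟩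
  x + x * suc k ∸ x ≡⟨ m+n∸m≡n x _ ⟩
  x * suc k      ∎)
  where
  open ≤-Reasoning
  M = suc (suc k)
  c = ⌈ x /1+ suc k ⌉

up≤⇒≤down : ∀ {k} x y → up k y ≤ x → y ≤ down (suc k) x
up≤⇒≤down {k} x y le = m+n≤o⇒m≤o∸n y (begin
  y + ⌈ x /1+ suc k ⌉  ≤⟨ +-monoʳ-≤ y (≤*⇒⌈/⌉≤ x x≤) ⟩
  y + (x ∸ y)          ≡⟨ m+[n∸m]≡n (m+n≤o⇒m≤o y le) ⟩
  x                    ∎)
  where
  open ≤-Reasoning
  M = suc (suc k)
  x≤ : x ≤ (x ∸ y) * M
  x≤ = begin
    x                         ≡⟨ m+n∸n≡m x (x * suc k) ⟨
    x + x * suc k ∸ x * suc k ≡⟨ cong (_∸ x * suc k) (*-suc x (suc k)) ⟨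
    x * M ∸ x * suc k         ≤⟨ ∸-monoʳ-≤ (x * M) (up≤⇒*≤ x y le) ⟩
    x * M ∸ y * M             ≡⟨ *-distribʳ-∸ M x y ⟨
    (x ∸ y) * M               ∎

least : ∀ {n} → Vec ℕ n → ℕ
least []              = 0
least {suc k} (y ∷ _) = up k y

-- Lecture hall partitions of width n padded with zeros to length n.
Lecture : ∀ {n} → Vec ℕ n → Set
Lecture []      = ⊤
Lecture (x ∷ v) = least v ≤ x × Lecture v

-- The entries y of v at odd positions become those at even positions; between
-- them the entries x of v, which range over an interval, are reflected in it.
step : ∀ {n} → ℕ → Vec ℕ n → Vec ℕ (suc n)
step s v@[]                    = s + least v ∷ []
step s v@(y ∷ [])              = s + least v ∷ y ∷ []
step {suc k} s v@(y ∷ x ∷ w)   = s + least v ∷ y ∷ step (down k y ∸ x) w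

least-step : ∀ {n} s (v : Vec ℕ n) → least (step s v) ≡ up n (s + least v)
least-step s []          = refl
least-step s (_ ∷ [])    = refl
least-step s (_ ∷ _ ∷ _) = refl

-- Since x lies between `least w` and `d = down (suc k) y`, its reflection `d ∸ x + least w` is at
-- most `d`; the Galois connection makes it admissible after y.
step-lecture : ∀ {n} s (v : Vec ℕ n) → Lecture v → Lecture (step s v)
step-lecture s []          _ = z≤n , tt
step-lecture s (y ∷ [])    l = m≤n+m _ s , l
step-lecture {suc (suc k)} s (y ∷ x ∷ w) (x≤y , w≤x , l) =
  m≤n+m _ s ,
  subst (_≤ y) (sym (least-step (d ∸ x) w)) (≤down⇒up≤ y _ bound) ,
  step-lecture (d ∸ x) w l
  where
  d = down (suc k) y
  bound : d ∸ x + least w ≤ d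
  bound = ≤-trans (+-monoʳ-≤ (d ∸ x) w≤x) (≤-reflexive (m∸n+n≡m (up≤⇒≤down y x x≤y)))

-- The second entries give y = y′. Recursion then yields equal tails and equal differences `d ∸ x`,
-- which can be cancelled because both subtrahends are at most `d`.
step-injective : ∀ {n} s t (v w : Vec ℕ n) → Lecture v → Lecture w →
                 step s v ≡ step t w → s ≡ t × v ≡ w
step-injective s t [] [] _ _ e = +-cancelʳ-≡ 0 s t (∷-injectiveˡ e) , refl
step-injective s t (y ∷ []) (y′ ∷ []) _ _ e
  with refl ← ∷-injectiveˡ (∷-injectiveʳ e) = +-cancelʳ-≡ _ s t (∷-injectiveˡ e) , refl
step-injective s t (y ∷ x ∷ v) (y′ ∷ x′ ∷ w) (x≤y , _ , lv) (x′≤y , _ , lw) e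
  with refl ← ∷-injectiveˡ (∷-injectiveʳ e)
  with s≡t , refl ← step-injective _ _ v w lv lw (∷-injectiveʳ (∷-injectiveʳ e)) =
  +-cancelʳ-≡ _ s t (∷-injectiveˡ e) ,
  cong (λ z → y ∷ z ∷ v) (∸-cancelˡ-≡ (up≤⇒≤down y x x≤y) (up≤⇒≤down y x′ x′≤y) s≡t)

step-surjective : ∀ {n} (u : Vec ℕ (suc n)) → Lecture u →
                  ∃[ s ] Σ[ v ∈ Vec ℕ n ] Lecture v × step s v ≡ u
step-surjective {zero} (z ∷ [])         _         = z , [] , tt , cong (_∷ []) (+-identityʳ z)
step-surjective {suc zero} (z ∷ y ∷ [])     (le , l)  =
  z ∸ least (y ∷ []) , y ∷ [] , l , cong (_∷ y ∷ []) (m∸n+n≡m le)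
step-surjective {suc (suc k)} (z ∷ y ∷ u) (le , u≤y , l)
  with s , v , lv , refl ← step-surjective u l =
  -- The excess s recovered from `u` has to be `d ∸ x`, so x is `d ∸ s`; `bound` provides both
  -- `s ≤ d` and `least v ≤ d ∸ s`.
  z ∸ up (suc k) y , y ∷ d ∸ s ∷ v ,
  (≤down⇒up≤ y _ (m∸n≤m d s) , m+n≤o⇒m≤o∸n (least v) (subst (_≤ d) (+-comm s _) bound) , lv) ,
  cong₂ (λ a b → a ∷ y ∷ step b v) (m∸n+n≡m le) (m∸[m∸n]≡n (m+n≤o⇒m≤o s bound))
  where
  d = down (suc k) y
  bound : s + least v ≤ d
  bound = up≤⇒≤down y _ (subst (_≤ y) (least-step s v) u≤y)

-- Sums over odd and even positions, counted from 1, and their change under a step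

odds evens : ∀ {n} → Vec ℕ n → ℕ
odds  []      = 0
odds  (x ∷ v) = x + evens v
evens []      = 0
evens (x ∷ v) = odds v

evens-step : ∀ {n} s (v : Vec ℕ n) → evens (step s v) ≡ odds v
evens-step s []          = refl
evens-step s (y ∷ [])    = refl
evens-step s (y ∷ x ∷ v) = cong (y +_) (evens-step _ v)

-- `evens v` stands on the left to avoid subtraction. Adding x to the entry that contains its
-- reflection `d ∸ x` leaves `d`, which together with `up` of the same y makes 2 y.
odds-step : ∀ {n} s (v : Vec ℕ n) → Lecture v → odds (step s v) + evens v ≡ s + 2 * odds v
odds-step s [] _ = lemma s
  where
  lemma : ∀ s → s + 0 + 0 + 0 ≡ s + 0
  lemma = solve-∀
-- No entry follows y here, but at width 1 its partner `down 0 y` is 0, so `up 0 y` alone is 2 y.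
odds-step s (y ∷ []) _ = trans (lemma s (up 0 y)) (cong (s +_) (trans
  (cong (up 0 y +_) (sym (down-0 y))) (trans (up+down 0 y) (cong (2 *_) (sym (+-identityʳ y))))))
  where
  lemma : ∀ s u → s + u + 0 + 0 ≡ s + (u + 0)
  lemma = solve-∀
  down-0 : ∀ y → down 0 y ≡ 0
  down-0 y = m≤n⇒m∸n≡0 {y} {⌈ y /1+ 0 ⌉} (≤-trans (⌈/⌉≤⇒≤* {0} y ≤-refl) (≤-reflexive (*-identityʳ _)))
odds-step {suc (suc k)} s (y ∷ x ∷ v) (x≤y , _ , l) = begin
  s + u + odds v′ + (x + evens v)       ≡⟨ lemma₁ s u (odds v′) x (evens v) ⟩
  s + (u + x + (odds v′ + evens v))     ≡⟨ cong (λ z → s + (u + x + z)) (odds-step _ v l) ⟩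
  s + (u + x + (d ∸ x + 2 * odds v))    ≡⟨ lemma₂ s u x (d ∸ x) (odds v) ⟩
  s + (u + (d ∸ x + x) + 2 * odds v)    ≡⟨ cong (λ z → s + (u + z + 2 * odds v)) (m∸n+n≡m (up≤⇒≤down y x x≤y)) ⟩
  s + (u + d + 2 * odds v)              ≡⟨ cong (λ z → s + (z + 2 * odds v)) (up+down (suc k) y) ⟩
  s + (2 * y + 2 * odds v)              ≡⟨ cong (s +_) (*-distribˡ-+ 2 y (odds v)) ⟨
  s + 2 * (y + odds v)                  ∎
  where
  open ≡-Reasoning
  u = up (suc k) y
  d = down (suc k) y
  v′ = step (d ∸ x) v
  lemma₁ : ∀ s u o x e → s + u + o + (x + e) ≡ s + (u + x + (o + e))
  lemma₁ = solve-∀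
  lemma₂ : ∀ s u x z o → s + (u + x + (z + 2 * o)) ≡ s + (u + (z + x) + 2 * o)
  lemma₂ = solve-∀

-- The last entry, the multiplicity of the part 1, is the excess of the outermost step; hence the
-- recursion on `init`.
toLecture : ∀ {n} → Vec ℕ n → Vec ℕ n
toLecture []        = []
toLecture c@(_ ∷ _) = step (last c) (toLecture (init c))

toLecture-∷ʳ : ∀ {n} (c : Vec ℕ n) s → toLecture (c ∷ʳ s) ≡ step s (toLecture c)
toLecture-∷ʳ []      s = refl
toLecture-∷ʳ (x ∷ c) s =
  cong₂ step (last-∷ʳ s (x ∷ c)) (cong toLecture (init-∷ʳ s (x ∷ c)))

toLecture-lecture : ∀ {n} (c : Vec ℕ n) → Lecture (toLecture c)
toLecture-lecture []        = tt
toLecture-lecture c@(_ ∷ _) = step-lecture (last c) (toLecture (init c)) (toLecture-lecture (init c))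

toLecture-injective : ∀ {n} (c d : Vec ℕ n) → toLecture c ≡ toLecture d → c ≡ d
toLecture-injective {zero} [] []        _ = refl
toLecture-injective {suc n} c d e
  with Vec.initLast c | Vec.initLast d
... | c′ , s , p | d′ , t , q
  with s≡t , e′ ← step-injective s t (toLecture c′) (toLecture d′) (toLecture-lecture c′) (toLecture-lecture d′)
    (trans (sym (toLecture-∷ʳ c′ s)) (trans (cong toLecture (sym p)) (trans e
    (trans (cong toLecture q) (toLecture-∷ʳ d′ t))))) =
  trans p (trans (cong₂ _∷ʳ_ (toLecture-injective c′ d′ e′) s≡t) (sym q))

toLecture-surjective : ∀ {n} (v : Vec ℕ n) → Lecture v → Σ[ c ∈ Vec ℕ n ] toLecture c ≡ v
toLecture-surjective {zero} []       _ = [] , refl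
toLecture-surjective {suc n} v l
  with s , w , lw , refl ← step-surjective v l
  with c , refl ← toLecture-surjective w lw = c ∷ʳ s , toLecture-∷ʳ c s

-- The first half is the alternating size, stated without subtraction. Both halves are proved
-- together because a step changes the size by an amount that depends on the alternating size.
toLecture-weights : ∀ {n} (c : Vec ℕ n) → let v = toLecture c in
                    odds v ≡ total c + evens v × odds v + evens v ≡ weight c
toLecture-weights {zero} []       = refl , refl
toLecture-weights {suc n} c with c′ , s , refl ← Vec.initLast c
  rewrite toLecture-∷ʳ c′ s | total-∷ʳ c′ s | weight-∷ʳ c′ s
        | evens-step s (toLecture c′)
  with o≡ , w≡ ← toLecture-weights c′ = odds≡ , (begin
    o′ + o                                ≡⟨ cong (_+ o) odds≡ ⟩
    s + total c′ + o + o                  ≡⟨ cong (λ z → s + total c′ + o + z) o≡ ⟩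
    s + total c′ + o + (total c′ + e)     ≡⟨ lemma₂ s (total c′) o e ⟩
    s + ((o + e) + 2 * total c′)          ≡⟨ cong (λ z → s + (z + 2 * total c′)) w≡ ⟩
    s + (weight c′ + 2 * total c′)        ∎)
  where
  open ≡-Reasoning
  v = toLecture c′
  o = odds v
  e = evens v
  o′ = odds (step s v)
  lemma₁ : ∀ s t e o → s + (o + (t + e + 0)) ≡ s + t + o + e
  lemma₁ = solve-∀
  lemma₂ : ∀ s t o e → s + t + o + (t + e) ≡ s + ((o + e) + 2 * t)
  lemma₂ = solve-∀
  -- Expanding one of the two copies of `o` in `odds-step` by `o≡` produces an `e` that cancels the
  -- one on the left.
  odds≡ : o′ ≡ s + total c′ + o
  odds≡ = +-cancelʳ-≡ e o′ (s + total c′ + o) (begin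
    o′ + e                        ≡⟨ odds-step s v (toLecture-lecture c′) ⟩
    s + (o + (o + 0))             ≡⟨ cong (λ z → s + (o + (z + 0))) o≡ ⟩
    s + (o + (total c′ + e + 0))  ≡⟨ lemma₁ s (total c′) e o ⟩
    s + total c′ + o + e          ∎)

-- Passing between zero-padded vectors and partitions

-- Cutting at the first zero loses nothing on a lecture hall vector, where only zeros can follow it
-- (`lecture-0∷`).
trim : ∀ {n} → Vec ℕ n → List ℕ
trim []              = []
trim (zero ∷ _)      = []
trim (x@(suc _) ∷ v) = x ∷ trim v

pad : ∀ n → List ℕ → Vec ℕ n
pad n       []      = replicate n 0
-- A default value; the lemmas on `pad` assume `length l ≤ n`.
pad zero    (_ ∷ _) = []
pad (suc n) (x ∷ l) = x ∷ pad n l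

up≤0⇒≡0 : ∀ {k} y → up k y ≤ 0 → y ≡ 0
up≤0⇒≡0 y le = n≤0⇒n≡0 (m+n≤o⇒m≤o y le)

lecture-0∷ : ∀ {n} (v : Vec ℕ n) → least v ≤ 0 → Lecture v → v ≡ replicate n 0
lecture-0∷ []      _  _         = refl
lecture-0∷ (y ∷ v) le (le′ , l) with refl ← up≤0⇒≡0 y le = cong (0 ∷_) (lecture-0∷ v le′ l)

least-zeros : ∀ n → least (replicate n 0) ≡ 0
least-zeros zero    = refl
least-zeros (suc n) = refl

lecture-zeros : ∀ n → Lecture (replicate n 0)
lecture-zeros zero    = tt
lecture-zeros (suc n) = ≤-reflexive (least-zeros n) , lecture-zeros n

trim-zeros : ∀ n → trim (replicate n 0) ≡ []
trim-zeros zero    = refl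
trim-zeros (suc n) = refl

-- Unnormalised fractions are compared by cross-multiplication, which is the inequality of `up≤⇒*≤`.
up≤⇒ratio : ∀ {k} x y → up k y ≤ x → (ℤ.+ y ℚ./ suc k) ℚ.≤ (ℤ.+ x ℚ./ suc (suc k))
up≤⇒ratio {k} x y le = ℚ.*≤* (subst₂ ℤ._≤_ (ℤₚ.pos-* y _) (ℤₚ.pos-* x _) (ℤ.+≤+ (up≤⇒*≤ x y le)))

ratio⇒up≤ : ∀ {k} x y → (ℤ.+ y ℚ./ suc k) ℚ.≤ (ℤ.+ x ℚ./ suc (suc k)) → up k y ≤ x
ratio⇒up≤ {k} x y le = *≤⇒up≤ x y (ℤₚ.drop‿+≤+
  (subst₂ ℤ._≤_ (sym (ℤₚ.pos-* y _)) (sym (ℤₚ.pos-* x _)) (ℚₚ.drop-*≤* le)))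

trim-lectureHall : ∀ {n} (v : Vec ℕ n) → Lecture v → LectureHall n (trim v)
trim-lectureHall []                 _ = ([] , []) , z≤n , []
trim-lectureHall (zero ∷ v)         _ = ([] , []) , z≤n , []
trim-lectureHall (suc x ∷ [])       _ = ([-] , z<s ∷ []) , s≤s z≤n , [-]
trim-lectureHall (suc x ∷ zero ∷ v) _ = ([-] , z<s ∷ []) , s≤s z≤n , [-]
trim-lectureHall (suc x ∷ suc y ∷ v) (y≤x , l)
  with (dec , pos) , len , ratio ← trim-lectureHall (suc y ∷ v) l =
  -- `y≤x` bounds `up` of the second entry, which is at least that entry, so weak decrease follows.
  (m+n≤o⇒m≤o (suc y) y≤x ∷ dec , z<s ∷ pos) , s≤s len , up≤⇒ratio (suc x) (suc y) y≤x ∷ ratio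

pad-lecture : ∀ n l → length l ≤ n → Linked ℚ._≥_ (ratios n l) → Lecture (pad n l)
pad-lecture n       []          _ _ = lecture-zeros n
pad-lecture (suc n) (x ∷ [])    _ _ = subst (_≤ x) (sym (least-zeros n)) z≤n , lecture-zeros n
pad-lecture (suc (suc n)) (x ∷ y ∷ l) (s≤s len) (y≤x ∷ ratio) =
  ratio⇒up≤ x y y≤x , pad-lecture (suc n) (y ∷ l) len ratio

trim-pad : ∀ n l → length l ≤ n → All (0 <_) l → trim (pad n l) ≡ l
trim-pad n       []          _         _         = trim-zeros n
trim-pad (suc n) (suc x ∷ l) (s≤s len) (_ ∷ pos) = cong (suc x ∷_) (trim-pad n l len pos)

trim-injective : ∀ {n} (v w : Vec ℕ n) → Lecture v → Lecture w → trim v ≡ trim w → v ≡ w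
trim-injective []          []          _        _        _ = refl
trim-injective (zero ∷ v)  (zero ∷ w)  (le , l) (le′ , l′) _ =
  cong (0 ∷_) (trans (lecture-0∷ v le l) (sym (lecture-0∷ w le′ l′)))
trim-injective (suc x ∷ v) (suc y ∷ w) (_ , l)  (_ , l′) e
  with refl ← Listₚ.∷-injectiveˡ e =
  cong (suc x ∷_) (trim-injective v w l l′ (Listₚ.∷-injectiveʳ e))

evens-zeros : ∀ n → evens (replicate n 0) ≡ 0
odds-zeros  : ∀ n → odds  (replicate n 0) ≡ 0
evens-zeros zero    = refl
evens-zeros (suc n) = odds-zeros n
odds-zeros zero    = refl
odds-zeros (suc n) = evens-zeros n

sum-trim : ∀ {n} (v : Vec ℕ n) → Lecture v → sum (trim v) ≡ odds v + evens v
sum-trim []         _ = refl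
sum-trim {suc n} (zero ∷ v) (le , l) with refl ← lecture-0∷ v le l =
  sym (cong₂ _+_ (evens-zeros n) (odds-zeros n))
sum-trim (suc x ∷ v) (_ , l) = cong suc (trans (cong (x +_) (sum-trim v l))
  (trans (cong (x +_) (+-comm (odds v) (evens v))) (sym (+-assoc x (evens v) (odds v)))))

altSum-trim : ∀ {n} (v : Vec ℕ n) → Lecture v → altSum (trim v) ≡ ℤ.+ odds v ℤ.- ℤ.+ evens v
altSum-trim []         _ = refl
altSum-trim {suc n} (zero ∷ v) (le , l) with refl ← lecture-0∷ v le l =
  sym (cong₂ (λ a b → ℤ.+ a ℤ.- ℤ.+ b) (evens-zeros n) (odds-zeros n))
altSum-trim (suc x ∷ v) (_ , l) = trans (cong (λ z → ℤ.+ suc x ℤ.- z) (altSum-trim v l))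
  (lemma (ℤ.+ suc x) (ℤ.+ odds v) (ℤ.+ evens v))
  where
  lemma : ∀ a b c → a ℤ.- (b ℤ.- c) ≡ (a ℤ.+ c) ℤ.- b
  lemma = ℤ-Solver.solve-∀

toLectureHall : ∀ {n} → Vec ℕ n → List ℕ
toLectureHall c = trim (toLecture c)

toLectureHall-injective : ∀ {n} {c d : Vec ℕ n} → toLectureHall c ≡ toLectureHall d → c ≡ d
toLectureHall-injective {c = c} {d} e = toLecture-injective c d
  (trim-injective _ _ (toLecture-lecture c) (toLecture-lecture d) e)

toLectureHall-surjective : ∀ {n l} → LectureHall n l → Σ[ c ∈ Vec ℕ n ] toLectureHall c ≡ l
toLectureHall-surjective {n} {l} ((_ , pos) , len , ratio)
  with c , e ← toLecture-surjective (pad n l) (pad-lecture n l len ratio) =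
  c , trans (cong trim e) (trim-pad n l len pos)

altSize-toLectureHall : ∀ {n} (c : Vec ℕ n) → altSize (toLectureHall c) ≡ total c
altSize-toLectureHall c = cong ∣_∣ (begin
  altSum (trim v)                           ≡⟨ altSum-trim v (toLecture-lecture c) ⟩
  ℤ.+ odds v ℤ.- ℤ.+ evens v                ≡⟨ cong (λ z → ℤ.+ z ℤ.- ℤ.+ evens v) (proj₁ (toLecture-weights c)) ⟩
  ℤ.+ (total c + evens v) ℤ.- ℤ.+ evens v   ≡⟨ lemma (ℤ.+ total c) (ℤ.+ evens v) ⟩
  ℤ.+ total c                               ∎)
  where
  open ≡-Reasoning
  v = toLecture c
  lemma : ∀ a b → a ℤ.+ b ℤ.- b ≡ a
  lemma = ℤ-Solver.solve-∀

sum-toLectureHall : ∀ {n} (c : Vec ℕ n) → sum (toLectureHall c) ≡ weight c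
sum-toLectureHall c =
  trans (sum-trim (toLecture c) (toLecture-lecture c)) (proj₂ (toLecture-weights c))

-- Partitions into odd parts

toOdd : ∀ {n} → Vec ℕ n → List ℕ
toOdd []                    = []
toOdd (zero ∷ v)            = toOdd v
toOdd {suc n} (suc c ∷ v)   = part n ∷ toOdd (c ∷ v)

part-odd : ∀ n → part n ≡ 1 + 2 * n
part-odd n = +-suc n (n + 0)

2∤part : ∀ n → ¬ 2 ∣ part n
2∤part n 2∣p with () ← ∣1⇒≡1 (∣m+n∣m⇒∣n
  (subst (2 ∣_) (trans (part-odd n) (+-comm 1 (2 * n))) 2∣p) (m∣m*n n))

-- The bound 2 (n + 1) is itself even, so an odd number cannot attain it.
odd≤⇒≤part : ∀ {n p} → ¬ 2 ∣ p → p ≤ 2 * suc n → p ≤ part n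
odd≤⇒≤part {n} 2∤p le with m≤n⇒m<n∨m≡n le
... | inj₁ lt   = ≤-pred lt
... | inj₂ refl = contradiction (m∣m*n (suc n)) 2∤p

oddParts-suc : ∀ {n l} → OddParts n l → OddParts (suc n) l
oddParts-suc (isP , odd) =
  isP , All.map (λ (2∤p , p≤) → 2∤p , ≤-trans p≤ (*-monoʳ-≤ 2 (n≤1+n _))) odd

oddParts-part∷ : ∀ {n l} → OddParts (suc n) l → OddParts (suc n) (part n ∷ l)
oddParts-part∷ {n} {l} ((dec , pos) , odd) =
  (link odd dec , subst (0 <_) (sym (part-odd n)) z<s ∷ pos) , (2∤part n , n≤1+n _) ∷ odd
  where
  link : ∀ {l} → All (λ p → ¬ 2 ∣ p × p ≤ 2 * suc n) l → Linked _≥_ l → Linked _≥_ (part n ∷ l)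
  link []                _   = [-]
  link ((2∤p , p≤) ∷ _) dec = odd≤⇒≤part 2∤p p≤ ∷ dec

toOdd-oddParts : ∀ {n} (c : Vec ℕ n) → OddParts n (toOdd c)
toOdd-oddParts []          = ([] , []) , []
toOdd-oddParts (zero ∷ v)  = oddParts-suc (toOdd-oddParts v)
toOdd-oddParts (suc c ∷ v) = oddParts-part∷ (toOdd-oddParts (c ∷ v))

-- As the parts decrease, only x needs a new bound: it is at most 2n + 1 by parity, and that value
-- is excluded.
oddParts-pred : ∀ {n x l} → OddParts (suc n) (x ∷ l) → x ≢ part n → OddParts n (x ∷ l)
oddParts-pred {n} {x} {l} (isP@(dec , _) , odd@((2∤x , x≤) ∷ _)) x≢p =
  isP , All.zip (All.map proj₁ odd , Linked⇒All (λ p q → ≤-trans q p) x≤2n dec)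
  where
  x≤2n : x ≤ 2 * n
  x≤2n = ≤-pred (subst (x <_) (part-odd n) (≤∧≢⇒< (odd≤⇒≤part 2∤x x≤) x≢p))

-- `part n` is 2n + 1, whereas parts of `toOdd v` are at most 2n. This tells zero from nonzero head
-- multiplicities in `toOdd-injective`.
part∷-∉-toOdd : ∀ {n l} (v : Vec ℕ n) → ¬ part n ∷ l ≡ toOdd v
part∷-∉-toOdd {n} v e with toOdd v | e | toOdd-oddParts v
... | _ | refl | _ , (_ , p≤) ∷ _ = <-irrefl refl (subst (_≤ 2 * n) (part-odd n) p≤)

toOdd-injective : ∀ {n} {c d : Vec ℕ n} → toOdd c ≡ toOdd d → c ≡ d
toOdd-injective {c = []}        {[]}        _ = refl
toOdd-injective {c = zero ∷ v}  {zero ∷ w}  e = cong (0 ∷_) (toOdd-injective e)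
toOdd-injective {c = zero ∷ v}  {suc d ∷ w} e = ⊥-elim (part∷-∉-toOdd v (sym e))
toOdd-injective {c = suc c ∷ v} {zero ∷ w}  e = ⊥-elim (part∷-∉-toOdd w e)
toOdd-injective {c = suc c ∷ v} {suc d ∷ w} e
  with refl ← toOdd-injective {c = c ∷ v} {d ∷ w} (Listₚ.∷-injectiveʳ e) = refl

toOdd-zeros : ∀ n → toOdd (replicate n 0) ≡ []
toOdd-zeros zero    = refl
toOdd-zeros (suc n) = toOdd-zeros n

toOdd-surjective : ∀ {n l} → OddParts n l → Σ[ c ∈ Vec ℕ n ] toOdd c ≡ l
toOdd-surjective {zero}  {[]}    _ = [] , refl
toOdd-surjective {zero}  {x ∷ l} ((_ , 0<x ∷ _) , (_ , x≤0) ∷ _) = contradiction x≤0 (<⇒≱ 0<x)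
-- At fixed width `go` strips copies of the largest part, recursing on the list; any other first
-- part lowers the width.
toOdd-surjective {suc n} = go
  where
  go : ∀ {l} → OddParts (suc n) l → Σ[ c ∈ Vec ℕ (suc n) ] toOdd c ≡ l
  go {[]}    _ = replicate (suc n) 0 , toOdd-zeros n
  go {x ∷ l} o@((dec , _ ∷ pos) , _ ∷ odd) with x ≟ part n
  ... | yes refl with c ∷ v , e ← go {l} ((Linked.tail dec , pos) , odd) =
    suc c ∷ v , cong (part n ∷_) e
  ... | no x≢p with v , e ← toOdd-surjective {n} (oddParts-pred o x≢p) = 0 ∷ v , e

length-toOdd : ∀ {n} (c : Vec ℕ n) → length (toOdd c) ≡ total c
length-toOdd []          = refl
length-toOdd (zero ∷ v)  = length-toOdd v
length-toOdd (suc c ∷ v) = cong suc (length-toOdd (c ∷ v))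

sum-toOdd : ∀ {n} (c : Vec ℕ n) → sum (toOdd c) ≡ weight c
sum-toOdd []                  = refl
sum-toOdd (zero ∷ v)          = sum-toOdd v
sum-toOdd {suc n} (suc c ∷ v) =
  trans (cong (part n +_) (sum-toOdd (c ∷ v))) (sym (+-assoc (part n) (c * part n) (weight v)))

-- Generating functions

∑-cong : ∀ n {f g : ℕ → ℤ} → (∀ k → f k ≡ g k) → ∑≤ n f ≡ ∑≤ n g
∑-cong zero    e = e 0
∑-cong (suc n) e = cong₂ ℤ._+_ (∑-cong n e) (e (suc n))

module _ {A : Set} where

  -- Follows the recursion of `∑≤`, so that lengths turn into sums clause by clause.
  ⋃≤ : ℕ → (ℕ → List A) → List A
  ⋃≤ zero    f = f 0
  ⋃≤ (suc n) f = ⋃≤ n f ++ f (suc n)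

  length-⋃ : ∀ n f → ℤ.+ length (⋃≤ n f) ≡ ∑≤ n (λ k → ℤ.+ length (f k))
  length-⋃ zero    f = refl
  length-⋃ (suc n) f = trans (cong ℤ.+_ (Listₚ.length-++ (⋃≤ n f)))
    (cong (ℤ._+ (ℤ.+ length (f (suc n)))) (length-⋃ n f))

  ∈-⋃⁺ : ∀ {n k x} f → k ≤ n → x ∈ f k → x ∈ ⋃≤ n f
  ∈-⋃⁺ {zero}  f z≤n x∈ = x∈
  ∈-⋃⁺ {suc n} f k≤  x∈ with m≤n⇒m<n∨m≡n k≤
  ... | inj₁ (s≤s k≤n) = ∈-++⁺ˡ (∈-⋃⁺ f k≤n x∈)
  ... | inj₂ refl      = ∈-++⁺ʳ (⋃≤ n f) x∈

  ∈-⋃⁻ : ∀ n {x} f → x ∈ ⋃≤ n f → ∃[ k ] k ≤ n × x ∈ f k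
  ∈-⋃⁻ zero    f x∈ = 0 , z≤n , x∈
  ∈-⋃⁻ (suc n) f x∈ with ∈-++⁻ (⋃≤ n f) x∈
  ... | inj₂ x∈r = suc n , ≤-refl , x∈r
  ... | inj₁ x∈l with k , k≤n , x∈k ← ∈-⋃⁻ n f x∈l = k , m≤n⇒m≤1+n k≤n , x∈k

  ⋃-unique : ∀ n f → (∀ k → Unique (f k)) → (∀ {k l x} → x ∈ f k → x ∈ f l → k ≡ l) →
             Unique (⋃≤ n f)
  ⋃-unique zero    f u d = u 0
  ⋃-unique (suc n) f u d = Uniqueₚ.++⁺ (⋃-unique n f u d) (u (suc n))
    λ (x∈l , x∈r) → let k , k≤n , x∈k = ∈-⋃⁻ n f x∈l in
      <-irrefl (d x∈k x∈r) (s≤s k≤n)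

-- A fibre of (a , b) listed without repetition.
record Fibre {A : Set} (a b : A → ℕ) (i j : ℕ) : Set where
  field
    elements : List A
    unique   : Unique elements
    mem      : ∀ {x} → x ∈ elements ⇔ (a x ≡ i × b x ≡ j)

open Fibre

-- s is the generating function Σₓ t^(a x) q^(b x) over all x : A.
Counts : {A : Set} → (A → ℕ) → (A → ℕ) → PowerSeries → Set
Counts a b s = ∀ i j → Σ[ φ ∈ Fibre a b i j ] ℤ.+ length (elements φ) ≡ s i j

t^q^-diag : ∀ {a b i j} → a ≡ i → b ≡ j → (t^ a q^ b) i j ≡ 1ℤ
t^q^-diag {a} {b} refl refl with a ≟ a | b ≟ b
... | yes _ | yes _ = refl
... | no a≢ | _     = contradiction refl a≢
... | yes _ | no b≢ = contradiction refl b≢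

t^q^-nonzero : ∀ {a b i j} → (t^ a q^ b) i j ≢ 0ℤ → a ≡ i × b ≡ j
t^q^-nonzero {a} {b} {i} {j} ≢0 with i ≟ a | j ≟ b
... | yes p | yes q = sym p , sym q
... | yes _ | no _  = contradiction refl ≢0
... | no _  | _     = contradiction refl ≢0

sumℤ-ones : ∀ {A : Set} (f : A → ℤ) xs → (∀ {x} → x ∈ xs → f x ≡ 1ℤ) →
            sumℤ (map f xs) ≡ ℤ.+ length xs
sumℤ-ones f []       _ = refl
sumℤ-ones f (x ∷ xs) e = cong₂ ℤ._+_ (e (here refl)) (sumℤ-ones f xs (λ x∈ → e (there x∈)))

-- A bijection f onto P that preserves exponents carries each fibre to the support of the
-- corresponding coefficient. All entries there are 1, so they add up to the size of the fibre.
Counts⇒HasSum : ∀ {A B : Set} {P : B → Set} {a b : A → ℕ} {c d : B → ℕ} {s} (f : A → B) →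
  (∀ {x y} → f x ≡ f y → x ≡ y) → (∀ x → P (f x)) → (∀ {y} → P y → Σ[ x ∈ A ] f x ≡ y) →
  (∀ x → c (f x) ≡ a x) → (∀ x → d (f x) ≡ b x) →
  Counts a b s → HasSum P (λ y → t^ c y q^ d y) s
Counts⇒HasSum {P = P} {c = c} {d} f inj image surj c≡ d≡ count i j =
  map f xs , Uniqueₚ.map⁺ inj (unique φ) , mk⇔ to from ,
  trans (sumℤ-ones _ (map f xs) (λ y∈ → let _ , c≡i , d≡j = weights y∈ in t^q^-diag c≡i d≡j))
        (trans (cong ℤ.+_ (Listₚ.length-map f xs)) (proj₂ (count i j)))
  where
  φ  = proj₁ (count i j)
  xs = elements φ
  weights : ∀ {y} → y ∈ map f xs → P y × c y ≡ i × d y ≡ j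
  weights y∈ with x , x∈ , refl ← ∈-map⁻ f y∈ with a≡ , b≡ ← Equivalence.to (mem φ) x∈ =
    image x , trans (c≡ x) a≡ , trans (d≡ x) b≡
  to : ∀ {y} → y ∈ map f xs → P y × (t^ c y q^ d y) i j ≢ 0ℤ
  to y∈ = let p , c≡i , d≡j = weights y∈ in
    p , λ ≡0 → contradiction (trans (sym (t^q^-diag c≡i d≡j)) ≡0) λ ()
  from : ∀ {y} → P y × (t^ c y q^ d y) i j ≢ 0ℤ → y ∈ map f xs
  from (p , ≢0) with x , refl ← surj p with c≡i , d≡j ← t^q^-nonzero ≢0 =
    ∈-map⁺ f (Equivalence.from (mem φ) (trans (sym (c≡ x)) c≡i , trans (sym (d≡ x)) d≡j))

Counts-resp-≈ : ∀ {A : Set} {a b : A → ℕ} {s s′} → s ≈ s′ → Counts a b s → Counts a b s′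
Counts-resp-≈ s≈ count i j = let φ , len = count i j in φ , trans len (s≈ i j)

Counts-singleton : ∀ {A : Set} {a b : A → ℕ} (x : A) → (∀ y → y ≡ x) → Counts a b (t^ a x q^ b x)
Counts-singleton {a = a} {b} x all≡ i j with i ≟ a x | j ≟ b x
... | yes refl | yes refl = record
  { elements = x ∷ []
  ; unique   = [] AllPairs.∷ AllPairs.[]
  ; mem      = mk⇔ (λ { (here refl) → refl , refl }) (λ _ → here (all≡ _))
  } , refl
... | yes _ | no j≢ = record
  { elements = []
  ; unique   = AllPairs.[]
  ; mem      = mk⇔ (λ ()) (λ (_ , b≡) → contradiction (trans (sym b≡) (cong b (all≡ _))) j≢)
  } , refl
... | no i≢ | _     = record
  { elements = []
  ; unique   = AllPairs.[]
  ; mem      = mk⇔ (λ ()) (λ (a≡ , _) → contradiction (trans (sym a≡) (cong a (all≡ _))) i≢)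
  } , refl

length-cartesianProductWith : ∀ {A B C : Set} (f : A → B → C) xs ys →
  length (cartesianProductWith f xs ys) ≡ length xs * length ys
length-cartesianProductWith f []       ys = refl
length-cartesianProductWith f (x ∷ xs) ys = trans (Listₚ.length-++ (map (f x) ys))
  (cong₂ _+_ (Listₚ.length-map (f x) ys) (length-cartesianProductWith f xs ys))

-- The Cauchy product: exponents add along the bijection f, so the fibre over (i , j) splits into
-- cells indexed by the exponents (k , l) of the first component, each cell a product of two fibres.
Counts-⊗ : ∀ {A B C : Set} {a a′ : A → ℕ} {b b′ : B → ℕ} {c c′ : C → ℕ} {s r}
  (f : A → B → C) →
  (∀ {w x y z} → f w y ≡ f x z → w ≡ x × y ≡ z) → (∀ z → ∃[ x ] ∃[ y ] f x y ≡ z) →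
  (∀ x y → c (f x y) ≡ a x + b y) → (∀ x y → c′ (f x y) ≡ a′ x + b′ y) →
  Counts a a′ s → Counts b b′ r → Counts c c′ (s ⊗ r)
Counts-⊗ {C = C} {a} {a′} {b} {b′} {c} {c′} {s} {r} f inj surj c≡ c′≡ F G i j =
  record { elements = ⋃≤ i row ; unique = rows-unique ; mem = mk⇔ to from } , size
  where
  φ : ∀ k l → Fibre a a′ k l
  φ k l = proj₁ (F k l)
  ψ : ∀ k l → Fibre b b′ (i ∸ k) (j ∸ l)
  ψ k l = proj₁ (G (i ∸ k) (j ∸ l))
  cell : ℕ → ℕ → List C
  cell k l = cartesianProductWith f (elements (φ k l)) (elements (ψ k l))
  row : ℕ → List C
  row k = ⋃≤ j (cell k)

  cell⁻ : ∀ {k l z} → z ∈ cell k l →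
          ∃[ x ] ∃[ y ] z ≡ f x y × (a x ≡ k × a′ x ≡ l) × (b y ≡ i ∸ k × b′ y ≡ j ∸ l)
  cell⁻ {k} {l} z∈
    with x , y , x∈ , y∈ , z≡ ← ∈-cartesianProductWith⁻ f (elements (φ k l)) (elements (ψ k l)) z∈ =
    x , y , z≡ , Equivalence.to (mem (φ k l)) x∈ , Equivalence.to (mem (ψ k l)) y∈

  -- By injectivity of f an element determines its first component, whose exponents are the indices
  -- of the cell.
  cell-disjoint : ∀ {k k′ l l′ z} → z ∈ cell k l → z ∈ cell k′ l′ → k ≡ k′ × l ≡ l′
  cell-disjoint z∈ z∈′ with cell⁻ z∈ | cell⁻ z∈′
  ... | _ , _ , refl , (refl , refl) , _ | _ , _ , e , (refl , refl) , _
    with refl , _ ← inj e = refl , refl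

  row-disjoint : ∀ {k k′ z} → z ∈ row k → z ∈ row k′ → k ≡ k′
  row-disjoint {k} {k′} z∈ z∈′ with ∈-⋃⁻ j (cell k) z∈ | ∈-⋃⁻ j (cell k′) z∈′
  ... | _ , _ , z∈c | _ , _ , z∈c′ = proj₁ (cell-disjoint z∈c z∈c′)

  rows-unique : Unique (⋃≤ i row)
  rows-unique = ⋃-unique i row
    (λ k → ⋃-unique j (cell k)
      (λ l → Uniqueₚ.cartesianProductWith⁺ f inj (unique (φ k l)) (unique (ψ k l)))
      (λ z∈ z∈′ → proj₂ (cell-disjoint z∈ z∈′)))
    row-disjoint

  to : ∀ {z} → z ∈ ⋃≤ i row → c z ≡ i × c′ z ≡ j
  to z∈ with k , k≤i , z∈r ← ∈-⋃⁻ i row z∈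
         with l , l≤j , z∈c ← ∈-⋃⁻ j (cell k) z∈r
         with x , y , refl , (a≡ , a′≡) , (b≡ , b′≡) ← cell⁻ z∈c =
    trans (c≡ x y) (trans (cong₂ _+_ a≡ b≡) (m+[n∸m]≡n k≤i)) ,
    trans (c′≡ x y) (trans (cong₂ _+_ a′≡ b′≡) (m+[n∸m]≡n l≤j))

  from : ∀ {z} → c z ≡ i × c′ z ≡ j → z ∈ ⋃≤ i row
  from {z} (c≡i , c′≡j) with x , y , refl ← surj z =
    ∈-⋃⁺ row (left a+b≡i) (∈-⋃⁺ (cell (a x)) (left a′+b′≡j)
      (∈-cartesianProductWith⁺ f
        (Equivalence.from (mem (φ (a x) (a′ x))) (refl , refl))
        (Equivalence.from (mem (ψ (a x) (a′ x))) (right a+b≡i , right a′+b′≡j))))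
    where
    a+b≡i : a x + b y ≡ i
    a+b≡i = trans (sym (c≡ x y)) c≡i
    a′+b′≡j : a′ x + b′ y ≡ j
    a′+b′≡j = trans (sym (c′≡ x y)) c′≡j
    left : ∀ {m n k} → m + n ≡ k → m ≤ k
    left {m} {n} refl = m≤m+n m n
    right : ∀ {m n k} → m + n ≡ k → n ≡ k ∸ m
    right {m} {n} refl = sym (m+n∸m≡n m n)

  size : ℤ.+ length (⋃≤ i row) ≡ (s ⊗ r) i j
  size = trans (length-⋃ i row) (∑-cong i λ k → trans (length-⋃ j (cell k)) (∑-cong j λ l →
    trans (cong ℤ.+_ (length-cartesianProductWith f (elements (φ k l)) (elements (ψ k l))))
    (trans (ℤₚ.pos-* (length (elements (φ k l))) (length (elements (ψ k l))))
    (cong₂ ℤ._*_ (proj₂ (F k l)) (proj₂ (G (i ∸ k) (j ∸ l)))))))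

-- `inverse` is here the geometric series of u = t q^d. The power `u ^^ n` counts a one-element set
-- with exponents n and n d, whose element is relabelled as the number n.
Counts-inverse : ∀ d → Counts (λ n → n) (λ n → n * d) (inverse (𝟙 ⊖ t^ 1 q^ d))
Counts-inverse d i j =
  record { elements = ⋃≤ (i + j) copies ; unique = copies-unique ; mem = mk⇔ to from } , size
  where
  u = 𝟙 ⊖ (𝟙 ⊖ t^ 1 q^ d)
  power : ∀ n → Counts {⊤} (λ _ → n) (λ _ → n * d) (u ^^ n)
  power zero    = Counts-singleton tt λ _ → refl
  power (suc n) = Counts-⊗ (λ _ _ → tt) (λ _ → refl , refl) (λ _ → tt , tt , refl)
    (λ _ _ → refl) (λ _ _ → refl)
    (Counts-resp-≈ (λ k l → lemma (𝟙 k l) ((t^ 1 q^ d) k l)) (Counts-singleton tt λ _ → refl))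
    (power n)
    where
    lemma : ∀ x y → y ≡ x ℤ.- (x ℤ.- y)
    lemma = ℤ-Solver.solve-∀
  φ : ∀ n → Fibre {⊤} (λ _ → n) (λ _ → n * d) i j
  φ n = proj₁ (power n i j)
  copies : ℕ → List ℕ
  copies n = map (λ _ → n) (elements (φ n))
  copies⁻ : ∀ {n m} → m ∈ copies n → m ≡ n × n ≡ i × n * d ≡ j
  copies⁻ {n} m∈ with _ , tt∈ , m≡n ← ∈-map⁻ (λ _ → n) m∈ =
    m≡n , Equivalence.to (mem (φ n)) tt∈
  copies-unique : Unique (⋃≤ (i + j) copies)
  copies-unique = ⋃-unique (i + j) copies
    (λ n → Uniqueₚ.map⁺ (λ _ → refl) (unique (φ n)))
    (λ m∈ m∈′ → trans (sym (proj₁ (copies⁻ m∈))) (proj₁ (copies⁻ m∈′)))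
  to : ∀ {m} → m ∈ ⋃≤ (i + j) copies → m ≡ i × m * d ≡ j
  to m∈ with n , _ , m∈n ← ∈-⋃⁻ (i + j) copies m∈ with refl , e ← copies⁻ m∈n = e
  from : ∀ {m} → m ≡ i × m * d ≡ j → m ∈ ⋃≤ (i + j) copies
  -- The exponent of t already forces m = i, which is within the truncation at i + j.
  from {m} e@(refl , _) = ∈-⋃⁺ copies (m≤m+n m j)
    (∈-map⁺ (λ _ → m) (Equivalence.from (mem (φ m) {tt}) e))
  size : ℤ.+ length (⋃≤ (i + j) copies) ≡ inverse (𝟙 ⊖ t^ 1 q^ d) i j
  size = trans (length-⋃ (i + j) copies) (∑-cong (i + j) λ n →
    trans (cong ℤ.+_ (Listₚ.length-map (λ _ → n) (elements (φ n))))
          (proj₂ (power n i j)))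

-- `∏₁` adjoins the factor of the largest part on the right, so the head multiplicity is the second
-- component of the pair.
Counts-Vec : ∀ n → Counts {Vec ℕ n} total weight (∏[1≤ k ≤ n ] inverse (𝟙 ⊖ t^ 1 q^ (2 * k ∸ 1)))
Counts-Vec zero    = Counts-singleton [] λ { [] → refl }
Counts-Vec (suc n) = Counts-⊗ (λ v c → c ∷ v)
  (λ e → ∷-injectiveʳ e , ∷-injectiveˡ e) (λ { (c ∷ v) → v , c , refl })
  (λ v c → +-comm c (total v)) (λ v c → +-comm (c * part n) (weight v))
  (Counts-Vec n) (Counts-inverse (part n))

theorem4p2 : (N : ℕ) → N ≥ 1 →
    HasSum (OddParts N) (λ ν → t^ length ν q^ sum ν) (∏[1≤ k ≤ N ] inverse (𝟙 ⊖ t^ 1 q^ (2 * k ∸ 1))) ×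
    HasSum (LectureHall N) (λ μ → t^ altSize μ q^ sum μ) (∏[1≤ k ≤ N ] inverse (𝟙 ⊖ t^ 1 q^ (2 * k ∸ 1)))
theorem4p2 N _ =
  Counts⇒HasSum toOdd toOdd-injective toOdd-oddParts toOdd-surjective
    length-toOdd sum-toOdd (Counts-Vec N) ,
  Counts⇒HasSum toLectureHall toLectureHall-injective
    (λ c → trim-lectureHall (toLecture c) (toLecture-lecture c)) toLectureHall-surjective
    altSize-toLectureHall sum-toLectureHall (Counts-Vec N)
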